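{- Let $m \geq 1$ be an integer. The pair of sequences $(\mathsf{G}, \mathsf{g}) = \big((\mathsf{G}_i)_{i \in \mathbb{N}}, (\mathsf{g}_i)_{i \in \mathbb{N}}\big)$ defined by $$\mathsf{G}_i = m^i\, i! \quad \text{and} \quad \mathsf{g}_i = m(i+1)-1$$ is a number system.
   Context: $\mathbb{N}=\{0,1,2,\dots\}$. Let $\mathsf{A} = (\mathsf{A}_i)_{i \in \mathbb{N}}$ be a sequence of positive integers and $\mathsf{a} = (\mathsf{a}_i)_{i \in \mathbb{N}}$ a sequence of nonnegative integers. The pair $(\mathsf{A}, \mathsf{a})$ is called a number system if, for every $n \in \mathbb{N}$, there exists $k \in \mathbb{N}$ such that $n = \sum_{i=0}^{k} \alpha_i \mathsf{A}_i$ with integers $\alpha_i \in \{0,1,\dots,\mathsf{a}_i\}$, and this representation in terms of the $\mathsf{A}_i$'s and $\alpha_i$'s is unique (two representations being identified if they differ only by leading terms with $\alpha_i = 0$). -}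

module Defs where

open import Algebra.Properties.Semiring.Sum using (sum)
open import Data.Fin.Base using (Fin; toℕ)
open import Data.Nat.Base using (ℕ; suc; _+_; _*_; _∸_; _^_; _≤_; _<_; _!)
open import Data.Nat.Properties using (+-*-semiring)
open import Data.Product.Base using (_×_)
open import Relation.Binary.PropositionalEquality.Core using (_≡_)

-- n = Σ_{i=0}^{k} αᵢ Aᵢ with αᵢ ∈ {0, …, aᵢ}; the index set {0, …, k} is Fin (suc k).
record Representation (A a : ℕ → ℕ) (n : ℕ) : Set where
  field
    k         : ℕ
    α         : Fin (suc k) → ℕ
    α≤a       : ∀ i → α i ≤ a (toℕ i)
    expansion : n ≡ sum +-*-semiring (λ i → α i * A (toℕ i))

-- Two representations are identified when they agree at every index they
-- share and every further (leading) digit of the longer one is zero.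
_≈_ : ∀ {A a n} → Representation A a n → Representation A a n → Set
R ≈ S =
    (∀ i j → toℕ i ≡ toℕ j → R.α i ≡ S.α j)
  × (∀ i → S.k < toℕ i → R.α i ≡ 0)
  × (∀ j → R.k < toℕ j → S.α j ≡ 0)
  where
  module R = Representation R
  module S = Representation S

record IsNumberSystem (A a : ℕ → ℕ) : Set where
  field
    positive  : ∀ i → 0 < A i
    represent : ∀ n → Representation A a n
    unique    : ∀ n (R S : Representation A a n) → R ≈ S

G : ℕ → ℕ → ℕ
G m i = m ^ i * i !

-- For m ≥ 1 the product is at least 1, so the subtraction is not truncated.
g : ℕ → ℕ → ℕ
g m i = m * (i + 1) ∸ 1

{-# OPTIONS --safe #-}

-- G (i + 1) = (g i + 1) G i, so (G, g) is a mixed radix system with G 0 = 1.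
-- Modulo A 1, the value of an expansion is its lowest term α 0 · A 0; removing
-- that term leaves an expansion in the shifted system (A (i + 1), a (i + 1)).
-- Hence digits are determined from the lowest up, and division with remainder
-- by a 0 + 1 produces them.
module Submission where

open import Defs
open import Algebra.Properties.Semiring.Sum using (sum)
open import Data.Fin.Base using (Fin; zero; suc; toℕ)
open import Data.Nat.Base
open import Data.Nat.DivMod
open import Data.Nat.Divisibility
open import Data.Nat.Properties
open import Data.Nat.Tactic.RingSolver using (solve-∀)
open import Data.Product.Base using (∃-syntax; _×_; _,_)
open import Data.Vec.Functional using (Vector; head; tail; _∷_)
open import Function.Base using (_∘_)
open import Relation.Binary.PropositionalEquality
open import Relation.Nullary.Negation using (contradiction)

MixedRadix : (A a : ℕ → ℕ) → Set
MixedRadix A a = ∀ i → A (suc i) ≡ suc (a i) * A i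

value : ∀ {n} → (ℕ → ℕ) → Vector ℕ n → ℕ
value A α = sum +-*-semiring (λ i → α i * A (toℕ i))

Bounded : ∀ {n} → (ℕ → ℕ) → Vector ℕ n → Set
Bounded a α = ∀ i → α i ≤ a (toℕ i)

mixedRadix-positive : ∀ A a → MixedRadix A a → 0 < A 0 → ∀ i → 0 < A i
mixedRadix-positive A a step A₀>0 zero    = A₀>0
mixedRadix-positive A a step A₀>0 (suc i) = begin-strict
  0                <⟨ mixedRadix-positive A a step A₀>0 i ⟩
  A i              ≤⟨ m≤m+n (A i) (a i * A i) ⟩
  suc (a i) * A i  ≡⟨ step i ⟨
  A (suc i)        ∎
  where open ≤-Reasoning

-- The tail is divisible by the lowest weight `A 1` of the shifted system, and `A 1` is itself a
-- multiple of `A 0`.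
A₀∣value : ∀ {n} A a → MixedRadix A a → (α : Vector ℕ n) → A 0 ∣ value A α
A₀∣value {zero}  A a step α = A 0 ∣0
A₀∣value {suc n} A a step α = ∣m∣n⇒∣m+n (n∣m*n (head α))
  (∣-trans (divides (suc (a 0)) (step 0))
           (A₀∣value (A ∘ suc) (a ∘ suc) (step ∘ suc) (tail α)))

-- Head and tail of a digit vector padded with infinitely many leading zeros.
head₀ : ∀ {n} → Vector ℕ n → ℕ
head₀ {zero}  α = 0
head₀ {suc n} α = head α

tail₀ : ∀ {n} → Vector ℕ n → Vector ℕ (pred n)
tail₀ {zero}  α = α
tail₀ {suc n} α = tail α

-- Indexing by all of `ℕ` lets digit vectors of different lengths be compared position by position.
digit : ∀ {n} → Vector ℕ n → ℕ → ℕ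
digit α zero    = head₀ α
digit α (suc i) = digit (tail₀ α) i

digit-toℕ : ∀ {n} (α : Vector ℕ n) i → digit α (toℕ i) ≡ α i
digit-toℕ α zero    = refl
digit-toℕ α (suc i) = digit-toℕ (tail α) i

digit-leading : ∀ {n} (α : Vector ℕ n) {i} → n ≤ i → digit α i ≡ 0
digit-leading {zero}  α {zero}  _         = refl
digit-leading {zero}  α {suc i} _         = digit-leading α {i} z≤n
digit-leading {suc n} α {suc i} (s≤s n≤i) = digit-leading (tail α) n≤i

value-head₀-tail₀ : ∀ {n} A (α : Vector ℕ n) →
  value A α ≡ head₀ α * A 0 + value (A ∘ suc) (tail₀ α)
value-head₀-tail₀ {zero}  A α = refl
value-head₀-tail₀ {suc n} A α = refl

head₀-bounded : ∀ {n} a (α : Vector ℕ n) → Bounded a α → head₀ α ≤ a 0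
head₀-bounded {zero}  a α α≤a = z≤n
head₀-bounded {suc n} a α α≤a = α≤a zero

tail₀-bounded : ∀ {n} a (α : Vector ℕ n) →
  Bounded a α → Bounded (a ∘ suc) (tail₀ α)
tail₀-bounded {suc n} a α α≤a i = α≤a (suc i)

-- `A 1` divides everything above the lowest term, and the lowest term is its own remainder because
-- `head₀ α ≤ a 0` gives `head₀ α * A 0 < suc (a 0) * A 0`, which is `A 1`.
value-mod : ∀ {n} A a → MixedRadix A a → .{{_ : NonZero (A 0)}} →
  .{{_ : NonZero (A 1)}} → (α : Vector ℕ n) → Bounded a α →
  value A α % A 1 ≡ head₀ α * A 0
value-mod A a step α α≤a = begin
  value A α % A 1                                      ≡⟨ cong (_% A 1) (value-head₀-tail₀ A α) ⟩
  (head₀ α * A 0 + value (A ∘ suc) (tail₀ α)) % A 1    ≡⟨ %-remove-+ʳ (head₀ α * A 0) A₁∣tail ⟩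
  head₀ α * A 0 % A 1                                  ≡⟨ m<n⇒m%n≡m head<A₁ ⟩
  head₀ α * A 0                                        ∎
  where
  open ≡-Reasoning
  A₁∣tail : A 1 ∣ value (A ∘ suc) (tail₀ α)
  A₁∣tail = A₀∣value (A ∘ suc) (a ∘ suc) (step ∘ suc) (tail₀ α)
  head<A₁ : head₀ α * A 0 < A 1
  head<A₁ = subst (head₀ α * A 0 <_) (sym (step 0))
    (*-monoˡ-< (A 0) (s≤s (head₀-bounded a α α≤a)))

-- Induction on the index `i`, with the system and both vectors varying: equal remainders modulo
-- `A 1` give equal lowest digits, and cancelling the lowest terms leaves equal values in the
-- shifted system.
digit-unique : ∀ {k l} A a → MixedRadix A a → 0 < A 0 →
  (α : Vector ℕ k) (β : Vector ℕ l) → Bounded a α → Bounded a β →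
  value A α ≡ value A β → ∀ i → digit α i ≡ digit β i
digit-unique A a step A₀>0 α β α≤a β≤a eq = λ where
    zero    → head-eq
    (suc i) → digit-unique (A ∘ suc) (a ∘ suc) (step ∘ suc) A₁>0 (tail₀ α) (tail₀ β)
                (tail₀-bounded a α α≤a) (tail₀-bounded a β β≤a) tail-eq i
  where
  open ≡-Reasoning
  A₁>0 : 0 < A 1
  A₁>0 = mixedRadix-positive A a step A₀>0 1
  instance
    A₀≢0 : NonZero (A 0)
    A₀≢0 = >-nonZero A₀>0
    A₁≢0 : NonZero (A 1)
    A₁≢0 = >-nonZero A₁>0
  head-eq : head₀ α ≡ head₀ β
  head-eq = *-cancelʳ-≡ (head₀ α) (head₀ β) (A 0) (begin
    head₀ α * A 0    ≡⟨ value-mod A a step α α≤a ⟨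
    value A α % A 1  ≡⟨ cong (_% A 1) eq ⟩
    value A β % A 1  ≡⟨ value-mod A a step β β≤a ⟩
    head₀ β * A 0    ∎)
  tail-eq : value (A ∘ suc) (tail₀ α) ≡ value (A ∘ suc) (tail₀ β)
  tail-eq = +-cancelˡ-≡ (head₀ α * A 0) _ _ (begin
    head₀ α * A 0 + value (A ∘ suc) (tail₀ α)  ≡⟨ value-head₀-tail₀ A α ⟨
    value A α                                  ≡⟨ eq ⟩
    value A β                                  ≡⟨ value-head₀-tail₀ A β ⟩
    head₀ β * A 0 + value (A ∘ suc) (tail₀ β)  ≡⟨ cong (λ h → h * A 0 + _) head-eq ⟨
    head₀ α * A 0 + value (A ∘ suc) (tail₀ β)  ∎)

-- The remainder becomes the lowest digit, and `suc (a 0)` copies of `A 0` are carried into one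
-- `A 1`.
divide-lowest : ∀ A a → MixedRadix A a → ∀ n →
  n * A 0 ≡ n % suc (a 0) * A 0 + n / suc (a 0) * A 1
divide-lowest A a step n = begin
  n * A 0                            ≡⟨ cong (_* A 0) (m≡m%n+[m/n]*n n b) ⟩
  (n % b + n / b * b) * A 0          ≡⟨ *-distribʳ-+ (A 0) (n % b) (n / b * b) ⟩
  n % b * A 0 + n / b * b * A 0      ≡⟨ cong (n % b * A 0 +_) (*-assoc (n / b) b (A 0)) ⟩
  n % b * A 0 + n / b * (b * A 0)    ≡⟨ cong (λ x → n % b * A 0 + n / b * x) (step 0) ⟨
  n % b * A 0 + n / b * A 1          ∎
  where
  open ≡-Reasoning
  b = suc (a 0)

-- Multiples of A 0 are represented, rather than all numbers, so that the
-- statement is stable under shifting the system.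
expand : ∀ k A a → MixedRadix A a → ∀ n → n * A 0 < A k →
  ∃[ α ] Bounded {k} a α × n * A 0 ≡ value A α
expand zero    A a step zero    n*A₀<A₀ = (λ ()) , (λ ()) , refl
-- With no digits available, the bound leaves room only for zero.
expand zero    A a step (suc n) n*A₀<A₀ = contradiction n*A₀<A₀ (m+n≮m (A 0) (n * A 0))
expand (suc k) A a step n       n*A₀<Aₖ =
  let b = suc (a 0)
      n≡r+qb = divide-lowest A a step n
      -- Dropping the remainder term preserves the bound, and `A (suc k)` is the weight at `k` in
      -- the shifted system.
      q*A₁<Aₖ = ≤-<-trans (m≤n+m (n / b * A 1) (n % b * A 0)) (subst (_< A (suc k)) n≡r+qb n*A₀<Aₖ)
      α , α≤a , eq = expand k (A ∘ suc) (a ∘ suc) (step ∘ suc) (n / b) q*A₁<Aₖ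
  in  n % b ∷ α
    , (λ { zero → m<1+n⇒m≤n (m%n<n n b) ; (suc i) → α≤a i })
    , trans n≡r+qb (cong (n % b * A 0 +_) eq)

-- `A 0 ≡ 1` turns multiples of `A 0` into arbitrary numbers. Unboundedness excludes weights that
-- become constant; it is stated at `suc k` because a representation with top index `k` has `suc k`
-- digits.
mixedRadix-isNumberSystem : ∀ A a → MixedRadix A a → A 0 ≡ 1 →
  (∀ n → ∃[ k ] n < A (suc k)) → IsNumberSystem A a
mixedRadix-isNumberSystem A a step A₀≡1 unbounded = record
  { positive  = mixedRadix-positive A a step A₀>0
  ; represent = represent
  ; unique    = unique
  }
  where
  A₀>0 : 0 < A 0
  A₀>0 = ≤-reflexive (sym A₀≡1)

  n*A₀≡n : ∀ n → n * A 0 ≡ n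
  n*A₀≡n n = trans (cong (n *_) A₀≡1) (*-identityʳ n)

  represent : ∀ n → Representation A a n
  represent n
    with k , n<A ← unbounded n
    with α , α≤a , eq ← expand (suc k) A a step n (subst (_< A (suc k)) (sym (n*A₀≡n n)) n<A)
    = record { k = k ; α = α ; α≤a = α≤a ; expansion = trans (sym (n*A₀≡n n)) eq }

  unique : ∀ n (R S : Representation A a n) → R ≈ S
  unique n R S =
      (λ i j i≡j → begin
        R.α i                ≡⟨ digit-toℕ R.α i ⟨
        digit R.α (toℕ i)    ≡⟨ digits-agree (toℕ i) ⟩
        digit S.α (toℕ i)    ≡⟨ cong (digit S.α) i≡j ⟩
        digit S.α (toℕ j)    ≡⟨ digit-toℕ S.α j ⟩
        S.α j                ∎)
    , (λ i k<i → begin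
        R.α i                ≡⟨ digit-toℕ R.α i ⟨
        digit R.α (toℕ i)    ≡⟨ digits-agree (toℕ i) ⟩
        -- `S.α` has length `suc S.k`, so `S.k < toℕ i` already says that the index is past its end.
        digit S.α (toℕ i)    ≡⟨ digit-leading S.α k<i ⟩
        0                    ∎)
    , (λ j k<j → begin
        S.α j                ≡⟨ digit-toℕ S.α j ⟨
        digit S.α (toℕ j)    ≡⟨ digits-agree (toℕ j) ⟨
        digit R.α (toℕ j)    ≡⟨ digit-leading R.α k<j ⟩
        0                    ∎)
    where
    open ≡-Reasoning
    module R = Representation R
    module S = Representation S
    digits-agree : ∀ i → digit R.α i ≡ digit S.α i
    digits-agree = digit-unique A a step A₀>0 R.α S.α R.α≤a S.α≤a
      (trans (sym R.expansion) S.expansion)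

G-mixedRadix : ∀ m .{{_ : NonZero m}} → MixedRadix (G m) (g m)
G-mixedRadix m i = begin
  m * m ^ i * (suc i * i !)              ≡⟨ rearrange m (m ^ i) i (i !) ⟩
  -- Positivity of `m * (i + 1)` makes the truncated subtraction in `g` exact.
  m * (i + 1) * (m ^ i * i !)            ≡⟨ cong (_* G m i) (m+[n∸m]≡n m[i+1]>0) ⟨
  suc (m * (i + 1) ∸ 1) * (m ^ i * i !)  ∎
  where
  open ≡-Reasoning
  rearrange : ∀ m p i f → m * p * (suc i * f) ≡ m * (i + 1) * (p * f)
  rearrange = solve-∀
  m[i+1]>0 : 0 < m * (i + 1)
  m[i+1]>0 = *-mono-≤ (>-nonZero⁻¹ m) (m≤n+m 1 i)

n<G[1+n] : ∀ m .{{_ : NonZero m}} n → n < G m (suc n)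
n<G[1+n] m n = begin-strict
  n                          <⟨ n<1+n n ⟩
  suc n                      ≡⟨ *-identityʳ (suc n) ⟨
  suc n * 1                  ≤⟨ *-monoʳ-≤ (suc n) (1≤n! n) ⟩
  suc n !                    ≤⟨ m≤n*m (suc n !) (m ^ suc n) {{m^n≢0 m (suc n)}} ⟩
  m ^ suc n * suc n !        ∎
  where open ≤-Reasoning

corollary1p4 : ∀ (m : ℕ) → m ≥ 1 → IsNumberSystem (G m) (g m)
corollary1p4 m m≥1 =
  -- `refl` applies because `m ^ 0 * 0 !` computes to 1; the top index chosen for `n` is `n` itself.
  mixedRadix-isNumberSystem (G m) (g m) (G-mixedRadix m) refl (λ n → n , n<G[1+n] m n)
  where
  instance
    m≢0 : NonZero m
    m≢0 = >-nonZero m≥1
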